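{- All positive integers except $1,2,4,6,8,12$ and $16$ are magic constants. That is, a positive integer $k$ is a magic constant if and only if $k \notin \{1,2,4,6,8,12,16\}$.
   Context: All graphs $G=(V,E)$ are finite, simple (undirected, no loops or multiple edges), with nonempty vertex set, and not necessarily connected. A positive integer $k$ is called a magic constant if there exist a graph $G=(V,E)$ and a bijection $f: V \to \{1,2,\dots,|V|\}$ such that for every vertex $v \in V$ the weight $w(v) = \sum_{u \in N(v)} f(u)$ equals $k$, where $N(v) = \{u \in V : uv \in E\}$ is the (open) neighborhood of $v$. -}

module Defs where

open import Data.Fin.Base using (Fin; toℕ)
open import Data.List.Base using (List; allFin; filter; map)
open import Data.Nat.Base using (ℕ; suc; NonZero)
open import Data.Nat.ListAction using (sum)
open import Data.Product.Base using (Σ-syntax)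
open import Function.Bundles using (_⤖_; module Bijection)
open import Level using (0ℓ)
open import Relation.Binary.Core using (Rel)
open import Relation.Binary.Definitions using (Decidable; Irreflexive; Symmetric)
open import Relation.Binary.PropositionalEquality.Core using (_≡_)

-- Finite vertex sets are taken to be of the form Fin n.  Adjacency is required
-- to be decidable so that open neighbourhoods can be enumerated.
record Graph : Set₁ where
  infix 4 _~_ _~?_
  field
    order    : ℕ
    order≢0  : NonZero order
    _~_      : Rel (Fin order) 0ℓ
    _~?_     : Decidable _~_
    ~-sym    : Symmetric _~_
    ~-irrefl : Irreflexive _≡_ _~_

  Vertex : Set
  Vertex = Fin order

  -- `allFin` has no repetitions, so each neighbour of v is listed exactly once.
  neighbours : Vertex → List Vertex
  neighbours v = filter (v ~?_) (allFin order)

  -- A bijection from the vertices to {1, …, order}, where i : Fin order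
  -- stands for the number suc (toℕ i).
  Labelling : Set
  Labelling = Vertex ⤖ Fin order

  label : Labelling → Vertex → ℕ
  label f v = suc (toℕ (Bijection.to f v))

  weight : Labelling → Vertex → ℕ
  weight f v = sum (map (label f) (neighbours v))

-- Only meant for positive k: an edgeless graph has all weights equal to 0.
IsMagicConstant : ℕ → Set₁
IsMagicConstant k =
  Σ[ G ∈ Graph ] let open Graph G in
  Σ[ f ∈ Labelling ] (∀ v → weight f v ≡ k)

{-# OPTIONS --safe #-}

-- If all weights equal k, then the vertex with the largest label has a neighbour,
-- so the order is at most k.  For the seven exceptional values of k the remaining
-- orders are refuted by an exhaustive search that removes the vertices by decreasing
-- label and keeps, for each other vertex, the weight still to be supplied.
--
-- For the existence part, split the labels into blocks of equal sum s, mostly pairs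
-- {i, s - i}.  A complete multipartite graph with c + 1 blocks as its parts has all
-- weights c * s, and disjoint unions preserve a common weight.  Two blocks give k = s,
-- which settles odd k.  Three blocks, or four blocks merged into two parts, give
-- k = 2s, which settles k = 2 mod 4 up to small cases.  For k = 4q with q ≥ 9 the
-- middle label q has no partner in a pair of sum s = 2q; there the labels
-- q - 8, …, q + 8 are put on a 4-regular graph of order 17, by translating a labelling
-- by 1, …, 17 with all weights 36, and the other labels are paired as before.  This
-- 4-regular graph and the graphs for small k were found by computer search.
module Submission where

open import Defs
open import Data.Bool.Base using (Bool; true; false; if_then_else_; T; _∧_; _∨_)
open import Data.Bool.ListAction using (any)
import Data.Bool.Properties as Bool
open import Data.Fin.Base using (Fin; toℕ)
open import Data.Fin.Properties using (toℕ-fromℕ<; toℕ-injective; toℕ<n)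
open import Data.List.Base
  using (List; []; _∷_; _++_; _∷ʳ_; allFin; applyDownFrom; concat; filter; filterᵇ; iterate;
         length; map; tabulate; upTo)
import Data.List.Membership.DecPropositional as DecMembership
open import Data.List.Membership.Propositional using (_∈_; _∉_)
open import Data.List.Membership.Propositional.Properties
  using (∈-++⁻; ∈-allFin; ∈-applyDownFrom⁺; ∈-filter⁺; ∈-filter⁻; ∈-map⁺; ∈-map⁻; ∈-tabulate⁺;
         ∈-upTo⁺)
open import Data.List.Membership.Propositional.Properties.WithK using (unique∧set⇒bag)
open import Data.List.Properties
  using (concat-++; filter-all; filter-++; map-tabulate; tabulate-cong; ++-identityʳ)
open import Data.List.Relation.Binary.BagAndSetEquality using (∼bag⇒↭)
open import Data.List.Relation.Binary.Disjoint.Propositional using (Disjoint)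
open import Data.List.Relation.Binary.Permutation.Propositional
  using (_↭_; ↭-refl; ↭-prep; ↭⇒↭ₛ; module PermutationReasoning)
open import Data.List.Relation.Binary.Permutation.Propositional.Properties
  using (∈-resp-↭; filter-↭; map⁺; ∷↭∷ʳ)
import Data.List.Relation.Binary.Permutation.Setoid.Properties as Permutation
open import Data.List.Relation.Unary.All using (All; []; _∷_; all?)
import Data.List.Relation.Unary.All as All
import Data.List.Relation.Unary.All.Properties as All
open import Data.List.Relation.Unary.AllPairs using ([]; _∷_)
open import Data.List.Relation.Unary.Any using (here; there)
open import Data.List.Relation.Unary.Unique.Propositional using (Unique)
import Data.List.Relation.Unary.Unique.Propositional.Properties as Unique
open import Data.Nat.Base
  using (ℕ; zero; suc; pred; NonZero; >-nonZero; _+_; _*_; _∸_; _%_; _≤_; _<_; _≤ᵇ_; _≡ᵇ_; z<s)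
open import Data.Nat.DivMod using (_mod_; m<n⇒m%n≡m; m%n<n)
open import Data.Nat.ListAction using (sum)
open import Data.Nat.ListAction.Properties using (sum-++; sum-↭)
open import Data.Nat.Properties
open import Data.Nat.Tactic.RingSolver using (solve-∀)
open import Data.Product.Base using (_×_; _,_; proj₁; proj₂; ∃)
open import Data.Sum.Base using (_⊎_; inj₁; inj₂)
open import Data.Vec.Base using (Vec; []; _∷_; replicate)
open import Function.Base using (_∘_; const)
open import Function.Bundles
  using (_⇔_; _↔_; mk⇔; module Bijection; module Equivalence; module Inverse)
open import Function.Construct.Identity using (⤖-id)
open import Function.Properties.Bijection using (⤖⇒↔)
open import Level using (0ℓ)
open import Relation.Binary.PropositionalEquality hiding ([_])
open import Relation.Nullary.Decidable
  using (Dec; yes; no; does; _×-dec_; dec-false; does-⇔; from-yes; toWitness; True)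
open import Relation.Nullary.Negation using (¬_; contradiction)
open import Relation.Unary using (Pred; Decidable)

open DecMembership _≟_ using (_∈?_)
open Equivalence using () renaming (from to from⇔)

private variable
  A B : Set
  k m n s : ℕ
  L M : List ℕ

-- Exceptional values

exceptions : List ℕ
exceptions = 1 ∷ 2 ∷ 4 ∷ 6 ∷ 8 ∷ 12 ∷ 16 ∷ []

-- A vector of length m lists, for the vertices with labels m, …, 1, how much
-- their neighbours among these m vertices must still contribute.  The vertex
-- labelled a is removed after choosing its neighbours, whose demands drop by a.
removeVertex : ℕ → ℕ → Vec ℕ m → (Vec ℕ m → Bool) → Bool
removeVertex a d []               next = (d ≡ᵇ 0) ∧ next []
removeVertex {suc m} a d (e ∷ es) next =
  removeVertex a d es (λ es′ → next (e ∷ es′)) ∨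
  (suc m ≤ᵇ d) ∧ (a ≤ᵇ e) ∧ removeVertex a (d ∸ suc m) es (λ es′ → next (e ∸ a ∷ es′))

completable : Vec ℕ m → Bool
completable []               = true
completable {suc m} (d ∷ ds) = removeVertex (suc m) d ds completable

-- The search is run during type checking. With `n` below `k` it covers the orders 1 to `k`, all
-- that `order≤constant` leaves open.
exceptions-not-completable :
  All (λ k → All (λ n → completable (replicate (suc n) k) ≡ false) (upTo k)) exceptions
exceptions-not-completable = from-yes
  (all? (λ k → all? (λ n → completable (replicate (suc n) k) Bool.≟ false) (upTo k)) exceptions)

-- Here and in descending, an index j stands for the label suc j.
weightBelow : (ℕ → Bool) → ℕ → ℕ
weightBelow c zero    = 0
weightBelow c (suc m) = (if c m then suc m else 0) + weightBelow c m

descending : ∀ m → (ℕ → A) → Vec A m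
descending zero    g = []
descending (suc m) g = g m ∷ descending m g

descending-const : ∀ {g : ℕ → A} {x} m →
                   (∀ {j} → j < m → g j ≡ x) → descending m g ≡ replicate m x
descending-const zero    eq = refl
descending-const (suc m) eq = cong₂ _∷_ (eq ≤-refl) (descending-const m (eq ∘ m<n⇒m<1+n))

descending-cong : ∀ {g h : ℕ → A} m → g ≗ h → descending m g ≡ descending m h
descending-cong zero    eq = refl
descending-cong (suc m) eq = cong₂ _∷_ (eq m) (descending-cong m eq)

-- The true neighbour set `c` tells which branch of the search succeeds. Demands have the form of
-- sums, so both comparisons pass and each subtraction undoes an addition.
removeVertex-complete : ∀ a c (g : ℕ → ℕ) m next → T (next (descending m g)) →
  T (removeVertex a (weightBelow c m) (descending m (λ j → (if c j then a else 0) + g j)) next)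
removeVertex-complete a c g zero    next ok = ok
removeVertex-complete a c g (suc m) next ok with c m
... | false = from⇔ Bool.T-∨ (inj₁ (removeVertex-complete a c g m (λ es′ → next (g m ∷ es′)) ok))
... | true  = from⇔ Bool.T-∨ (inj₂ (from⇔ Bool.T-∧
  ( ≤⇒≤ᵇ (m≤m+n (suc m) (weightBelow c m))
  , from⇔ Bool.T-∧ (≤⇒≤ᵇ (m≤m+n a (g m)) , chosen))))
  where
  chosen : T (removeVertex a (suc m + weightBelow c m ∸ suc m)
             (descending m (λ j → (if c j then a else 0) + g j))
             (λ es′ → next (a + g m ∸ a ∷ es′)))
  chosen rewrite m+n∸m≡n m (weightBelow c m) | m+n∸m≡n a (g m) =
    removeVertex-complete a c g m (λ es′ → next (g m ∷ es′)) ok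

-- Removing the top vertex leaves the demands of the graph induced on the smaller labels, so by
-- induction the search succeeds along any actual graph.
adjacency⇒completable : (adj : ℕ → ℕ → Bool) →
  (∀ i j → adj i j ≡ adj j i) → (∀ i → adj i i ≡ false) → ∀ m →
  T (completable (descending m (λ i → weightBelow (adj i) m)))
adjacency⇒completable adj adj-sym irrefl zero = _
adjacency⇒completable adj adj-sym irrefl (suc m)
  -- The top vertex adds nothing to its own demand; symmetry turns `adj i m` into the test `adj m i`
  -- made at its removal.
  rewrite irrefl m
        | descending-cong m (λ i →
            cong (λ b → (if b then suc m else 0) + weightBelow (adj i) m) (adj-sym i m)) =
  removeVertex-complete (suc m) (adj m) (λ i → weightBelow (adj i) m) m completable
    (adjacency⇒completable adj adj-sym irrefl m)

weightBelow-filter : {P : Pred A 0ℓ} (P? : Decidable P) (label : A → ℕ) (v : ℕ → A) →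
  ∀ m → (∀ {j} → j < m → label (v j) ≡ suc j) →
  weightBelow (does ∘ P? ∘ v) m ≡ sum (map label (filter P? (applyDownFrom v m)))
weightBelow-filter P? label v zero    eq = refl
weightBelow-filter P? label v (suc m) eq with does (P? (v m))
... | true  = cong₂ _+_ (sym (eq ≤-refl)) (weightBelow-filter P? label v m (eq ∘ m<n⇒m<1+n))
... | false = weightBelow-filter P? label v m (eq ∘ m<n⇒m<1+n)

∈⇒≤sum : ∀ {n ns} → n ∈ ns → n ≤ sum ns
∈⇒≤sum (here refl)        = m≤m+n _ _
∈⇒≤sum {ns = m ∷ _} (there n∈) = ≤-trans (∈⇒≤sum n∈) (m≤n+m _ m)

-- Labelled graphs as input of the search

module _ (G : Graph) (f : Graph.Labelling G) where
  open Graph G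

  private instance
    _ = order≢0

  inverse : Vertex ↔ Fin order
  inverse = ⤖⇒↔ f

  -- The inverse labelling made total: reduction modulo `order` matters only out of range, and keeps
  -- `adjacent` symmetric and irreflexive on all indices.
  vertex : ℕ → Vertex
  vertex j = Inverse.from inverse (j mod order)

  label-vertex : ∀ {j} → j < order → label f (vertex j) ≡ suc j
  label-vertex {j} j<n = cong suc (begin
    toℕ (Bijection.to f (vertex j)) ≡⟨ cong toℕ (Inverse.strictlyInverseˡ inverse (j mod order)) ⟩
    toℕ (j mod order)               ≡⟨ toℕ-fromℕ< (m%n<n j order) ⟩
    j % order                       ≡⟨ m<n⇒m%n≡m j<n ⟩
    j                               ∎)
    where open ≡-Reasoning

  -- Both lists are free of repetitions and contain every vertex. This allows weights to be summed
  -- by decreasing label.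
  vertices-↭ : applyDownFrom vertex order ↭ allFin order
  vertices-↭ = ∼bag⇒↭ (unique∧set⇒bag
    (Unique.applyDownFrom⁺₁ vertex order distinct)
    (Unique.allFin⁺ order)
    (λ {v} → mk⇔ (λ _ → ∈-allFin v) (λ _ → listed v)))
    where
    distinct : ∀ {i j} → j < i → i < order → vertex i ≢ vertex j
    distinct j<i i<n eq = >⇒≢ j<i (suc-injective
      (trans (sym (label-vertex i<n)) (trans (cong (label f) eq) (label-vertex (<-trans j<i i<n)))))

    vertex-label : ∀ v → vertex (toℕ (Bijection.to f v)) ≡ v
    vertex-label v = Bijection.injective f
      (toℕ-injective (suc-injective (label-vertex (toℕ<n (Bijection.to f v)))))

    listed : ∀ v → v ∈ applyDownFrom vertex order
    listed v = subst (_∈ _) (vertex-label v) (∈-applyDownFrom⁺ vertex (toℕ<n (Bijection.to f v)))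

  adjacent : ℕ → ℕ → Bool
  adjacent i j = does (vertex i ~? vertex j)

  weightBelow-order : ∀ i → weightBelow (adjacent i) order ≡ weight f (vertex i)
  weightBelow-order i = trans
    (weightBelow-filter (vertex i ~?_) (label f) vertex order label-vertex)
    (sum-↭ (map⁺ (label f) (filter-↭ (vertex i ~?_) vertices-↭)))

  constant⇒completable : (∀ v → weight f v ≡ k) → T (completable (replicate order k))
  constant⇒completable w = subst (T ∘ completable)
    (descending-const order (λ {i} _ → trans (weightBelow-order i) (w (vertex i))))
    (adjacency⇒completable adjacent
      (λ i j → does-⇔ (mk⇔ ~-sym ~-sym) (vertex i ~? vertex j) (vertex j ~? vertex i))
      (λ i → dec-false (vertex i ~? vertex i) (~-irrefl refl))
      order)

  neighbour : ∀ {v} → 0 < weight f v → ∃ (v ~_)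
  neighbour {v} 0<w with neighbours v in eq
  ... | []    = contradiction 0<w λ ()
  ... | u ∷ _ = u , proj₂ (∈-filter⁻ (v ~?_) {xs = allFin order} (subst (u ∈_) (sym eq) (here refl)))

  -- As `k` is positive, `v` has a neighbour `u`, and the label of `v` is a summand of the weight of
  -- `u`.
  label≤constant : 0 < k → (∀ v → weight f v ≡ k) → ∀ v → label f v ≤ k
  label≤constant 0<k w v with neighbour (subst (0 <_) (sym (w v)) 0<k)
  ... | u , v~u = subst (label f v ≤_) (w u)
    (∈⇒≤sum (∈-map⁺ (label f) (∈-filter⁺ (u ~?_) (∈-allFin v) (~-sym v~u))))

  order≤constant : 0 < k → (∀ v → weight f v ≡ k) → order ≤ k
  order≤constant 0<k w = subst (_≤ _)
    (trans (label-vertex (≤-reflexive (suc-pred order))) (suc-pred order))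
    -- The index `pred order` carries the largest label, `order` itself.
    (label≤constant 0<k w (vertex (pred order)))

not-constant : 0 < k → k ∈ exceptions → ¬ IsMagicConstant k
not-constant {k} 0<k k∈ (G , f , w) = contradiction (constant⇒completable G f w)
  (not-completable order {{order≢0}} (order≤constant G f 0<k w))
  where
  open Graph G

  -- Order 0 has to be excluded, since the empty vector is completable.
  not-completable : ∀ n → .{{NonZero n}} → n ≤ k → ¬ T (completable (replicate n k))
  not-completable (suc n) n<k = subst (¬_ ∘ T)
    (sym (All.lookup (All.lookup exceptions-not-completable k∈) (∈-upTo⁺ n<k))) λ ()

-- Combining labelled graphs

filterᵇ-cong : {p q : A → Bool} {xs : List A} →
               All (λ x → p x ≡ q x) xs → filterᵇ p xs ≡ filterᵇ q xs
filterᵇ-cong [] = refl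
filterᵇ-cong {q = q} {x ∷ xs} (eq ∷ eqs) rewrite eq with q x
... | true  = cong (x ∷_) (filterᵇ-cong eqs)
... | false = filterᵇ-cong eqs

filterᵇ-map : (p : B → Bool) (f : A → B) (xs : List A) →
              filterᵇ p (map f xs) ≡ map f (filterᵇ (p ∘ f) xs)
filterᵇ-map p f []       = refl
filterᵇ-map p f (x ∷ xs) with p (f x)
... | true  = cong (f x ∷_) (filterᵇ-map p f xs)
... | false = filterᵇ-map p f xs

Unique-++⁻ : (xs : List A) {ys : List A} → Unique (xs ++ ys) →
             Unique xs × Unique ys × Disjoint xs ys
Unique-++⁻ []       ys! = [] , ys! , λ ()
Unique-++⁻ (x ∷ xs) (x∉ ∷ xs++ys!) with Unique-++⁻ xs xs++ys!
... | xs! , ys! , xs#ys = All.++⁻ˡ xs x∉ ∷ xs! , ys! , λ where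
  (here refl , v∈ys)  → All.lookup (All.++⁻ʳ xs x∉) v∈ys refl
  (there v∈xs , v∈ys) → xs#ys (v∈xs , v∈ys)

Unique-resp-↭ : {xs ys : List A} → xs ↭ ys → Unique xs → Unique ys
Unique-resp-↭ {A = A} p = Permutation.Unique-resp-↭ (setoid A) (↭⇒↭ₛ p)

sum-map-+ʳ : ∀ c ns → sum (map (_+ c) ns) ≡ sum ns + length ns * c
sum-map-+ʳ c []       = refl
sum-map-+ʳ c (n ∷ ns) rewrite sum-map-+ʳ c ns = lemma n c (sum ns) (length ns * c)
  where
  lemma : ∀ n c x y → n + c + (x + y) ≡ n + x + (c + y)
  lemma = solve-∀

-- Vertices are identified with their labels, which are listed in L.
record Magic (k : ℕ) (L : List ℕ) : Set where
  field
    adj    : ℕ → ℕ → Bool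
    sym-on : ∀ {u v} → u ∈ L → v ∈ L → adj u v ≡ adj v u
    irrefl : ∀ {v} → v ∈ L → adj v v ≡ false
    weight : ∀ {v} → v ∈ L → sum (filterᵇ (adj v) L) ≡ k

open Magic

labels : ℕ → ℕ → List ℕ
labels = iterate suc

tabulate-labels : ∀ a n → tabulate {n = n} (λ i → a + toℕ i) ≡ labels a n
tabulate-labels a zero    = refl
tabulate-labels a (suc n) = cong₂ _∷_ (+-identityʳ a)
  (trans (tabulate-cong (λ i → +-suc a (toℕ i))) (tabulate-labels (suc a) n))

labels-unique : ∀ a n → Unique (labels a n)
labels-unique a n = subst Unique (tabulate-labels a n)
  (Unique.tabulate⁺ (λ eq → toℕ-injective (+-cancelˡ-≡ a _ _ eq)))

-- Vertices already are their labels, so the identity is the labelling; sums ignore order, so `L`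
-- may list the labels in any order.
magic⇒constant : 0 < n → labels 1 n ↭ L → Magic k L → IsMagicConstant k
magic⇒constant {n} {L} {k} 0<n p m = G , ⤖-id _ , weight-G
  where
  label′ : Fin n → ℕ
  label′ i = suc (toℕ i)

  labels≡ : map label′ (allFin n) ≡ labels 1 n
  labels≡ = trans (map-tabulate (λ i → i) label′) (tabulate-labels 1 n)

  label∈ : ∀ i → label′ i ∈ L
  label∈ i = ∈-resp-↭ p (subst (label′ i ∈_) (tabulate-labels 1 n) (∈-tabulate⁺ {f = label′} i))

  G : Graph
  G = record
    { order    = n
    ; order≢0  = >-nonZero 0<n
    ; _~_      = λ i j → T (adj m (label′ i) (label′ j))
    ; _~?_     = λ i j → Bool.T? (adj m (label′ i) (label′ j))
    ; ~-sym    = λ {i} {j} → subst T (sym-on m (label∈ i) (label∈ j))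
    ; ~-irrefl = λ { {i} refl → subst T (irrefl m (label∈ i)) }
    }

  open ≡-Reasoning

  weight-G : ∀ i → Graph.weight G (⤖-id _) i ≡ k
  weight-G i = begin
    sum (map label′ (filterᵇ (adj m (label′ i) ∘ label′) (allFin n)))
      ≡⟨ cong sum (filterᵇ-map (adj m (label′ i)) label′ (allFin n)) ⟨
    sum (filterᵇ (adj m (label′ i)) (map label′ (allFin n)))
      ≡⟨ cong (sum ∘ filterᵇ (adj m (label′ i))) labels≡ ⟩
    sum (filterᵇ (adj m (label′ i)) (labels 1 n))
      ≡⟨ sum-↭ (filter-↭ (Bool.T? ∘ adj m (label′ i)) p) ⟩
    sum (filterᵇ (adj m (label′ i)) L)
      ≡⟨ weight m (label∈ i) ⟩
    k ∎

sum-filterᵇ-false : ∀ ns → sum (filterᵇ (λ _ → false) ns) ≡ 0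
sum-filterᵇ-false []       = refl
sum-filterᵇ-false (n ∷ ns) = sum-filterᵇ-false ns

independent : ∀ L → Magic 0 L
independent L = record
  { adj    = λ _ _ → false
  ; sym-on = λ _ _ → refl
  ; irrefl = λ _ → refl
  ; weight = λ _ → sum-filterᵇ-false L
  }

empty : Magic k []
empty = record { adj = λ _ _ → false ; sym-on = λ () ; irrefl = λ () ; weight = λ () }

-- The join (b = true) or the disjoint union (b = false) of two graphs.
module _ (b : Bool) where

  -- The contribution of the opposite side to a weight: its full sum in a join, 0 in a disjoint
  -- union.
  cross : List ℕ → ℕ
  cross ns = sum (filterᵇ (const b) ns)

  glue : ∀ {j l} → Disjoint L M → Magic j L → Magic l M →
         j + cross M ≡ k → l + cross L ≡ k → Magic k (L ++ M)
  glue {L} {M} {k} {j} {l} L#M g h j+≡k l+≡k = record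
    { adj    = adj′
    ; sym-on = sym-on′
    ; irrefl = irrefl′
    ; weight = weight′
    }
    where
    inM : ∀ {v} → v ∈ L ++ M → v ∉ L → v ∈ M
    inM v∈ v∉L with ∈-++⁻ L v∈
    ... | inj₁ v∈L = contradiction v∈L v∉L
    ... | inj₂ v∈M = v∈M

    adj′ : ℕ → ℕ → Bool
    -- Anything outside `L` is treated as a member of `M`, which is correct on `L ++ M`.
    adj′ u v with u ∈? L | v ∈? L
    ... | yes _ | yes _ = adj g u v
    ... | no  _ | no  _ = adj h u v
    ... | _     | _     = b

    sym-on′ : ∀ {u v} → u ∈ L ++ M → v ∈ L ++ M → adj′ u v ≡ adj′ v u
    sym-on′ {u} {v} u∈ v∈ with u ∈? L | v ∈? L
    ... | yes p | yes q = sym-on g p q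
    ... | yes _ | no  _ = refl
    ... | no  _ | yes _ = refl
    ... | no  p | no  q = sym-on h (inM u∈ p) (inM v∈ q)

    irrefl′ : ∀ {v} → v ∈ L ++ M → adj′ v v ≡ false
    irrefl′ {v} v∈ with v ∈? L
    ... | yes p = irrefl g p
    ... | no  p = irrefl h (inM v∈ p)

    inside-L : ∀ {v} → v ∈ L → ∀ {u} → u ∈ L → adj′ v u ≡ adj g v u
    inside-L {v} v∈L {u} u∈L with v ∈? L | u ∈? L
    ... | yes _ | yes _ = refl
    ... | yes _ | no  q = contradiction u∈L q
    ... | no  p | _     = contradiction v∈L p

    from-L : ∀ {v} → v ∈ L → ∀ {u} → u ∈ M → adj′ v u ≡ b
    from-L {v} v∈L {u} u∈M with v ∈? L | u ∈? L
    ... | yes _ | yes q = contradiction (q , u∈M) L#M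
    ... | yes _ | no  _ = refl
    ... | no  p | _     = contradiction v∈L p

    inside-M : ∀ {v} → v ∉ L → ∀ {u} → u ∈ M → adj′ v u ≡ adj h v u
    inside-M {v} v∉L {u} u∈M with v ∈? L | u ∈? L
    ... | yes p | _     = contradiction p v∉L
    ... | no  _ | yes q = contradiction (q , u∈M) L#M
    ... | no  _ | no  _ = refl

    from-M : ∀ {v} → v ∉ L → ∀ {u} → u ∈ L → adj′ v u ≡ b
    from-M {v} v∉L {u} u∈L with v ∈? L | u ∈? L
    ... | yes p | _     = contradiction p v∉L
    ... | no  _ | yes _ = refl
    ... | no  _ | no  q = contradiction u∈L q

    sum-filterᵇ-cong : ∀ {p q : ℕ → Bool} {ns} → (∀ {n} → n ∈ ns → p n ≡ q n) →
                       sum (filterᵇ p ns) ≡ sum (filterᵇ q ns)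
    sum-filterᵇ-cong eq = cong sum (filterᵇ-cong (All.tabulate eq))

    split : ∀ v → sum (filterᵇ (adj′ v) (L ++ M)) ≡
                  sum (filterᵇ (adj′ v) L) + sum (filterᵇ (adj′ v) M)
    split v = trans (cong sum (filter-++ (Bool.T? ∘ adj′ v) L M)) (sum-++ (filterᵇ (adj′ v) L) _)

    weight′ : ∀ {v} → v ∈ L ++ M → sum (filterᵇ (adj′ v) (L ++ M)) ≡ k
    weight′ {v} v∈ = trans (split v) (by-side (v ∈? L))
      where
      by-side : Dec (v ∈ L) → sum (filterᵇ (adj′ v) L) + sum (filterᵇ (adj′ v) M) ≡ k
      by-side (yes v∈L) = trans
        (cong₂ _+_ (trans (sum-filterᵇ-cong (inside-L v∈L)) (weight g v∈L))
                   (sum-filterᵇ-cong (from-L v∈L)))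
        j+≡k
      by-side (no v∉L) = trans
        (cong₂ _+_ (sum-filterᵇ-cong (from-M v∉L))
                   (trans (sum-filterᵇ-cong (inside-M v∉L)) (weight h (inM v∈ v∉L))))
        (trans (+-comm _ l) l+≡k)

disjointUnion : Disjoint L M → Magic k L → Magic k M → Magic k (L ++ M)
disjointUnion {L} {M} {k} L#M g h = glue false L#M g h
  (trans (cong (k +_) (sum-filterᵇ-false M)) (+-identityʳ k))
  (trans (cong (k +_) (sum-filterᵇ-false L)) (+-identityʳ k))

join : ∀ {j l} → Disjoint L M → Magic j L → Magic l M →
       j + sum M ≡ k → l + sum L ≡ k → Magic k (L ++ M)
join {L} {M} L#M g h j+≡k l+≡k = glue true L#M g h
  (trans (cong (_ +_) (all M)) j+≡k) (trans (cong (_ +_) (all L)) l+≡k)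
  where
  all : ∀ ns → sum (filterᵇ (const true) ns) ≡ sum ns
  all ns = cong sum (filter-all (Bool.T? ∘ const true) (All.universal _ ns))

-- Regularity makes a translation of all labels by c add d * c to every weight.
translate : ∀ c d (m : Magic k L) → (∀ {v} → v ∈ L → length (filterᵇ (adj m v) L) ≡ d) →
            Magic (k + d * c) (map (_+ c) L)
translate {k} {L} c d m regular = record
  { adj    = adj′
  ; sym-on = sym-on′
  ; irrefl = irrefl′
  ; weight = weight′
  }
  where
  adj′ : ℕ → ℕ → Bool
  adj′ u v = adj m (u ∸ c) (v ∸ c)

  sym-on′ : ∀ {u v} → u ∈ map (_+ c) L → v ∈ map (_+ c) L → adj′ u v ≡ adj′ v u
  sym-on′ u∈ v∈ with ∈-map⁻ (_+ c) u∈ | ∈-map⁻ (_+ c) v∈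
  ... | u , u∈L , refl | v , v∈L , refl
    rewrite m+n∸n≡m u c | m+n∸n≡m v c = sym-on m u∈L v∈L

  irrefl′ : ∀ {v} → v ∈ map (_+ c) L → adj′ v v ≡ false
  irrefl′ v∈ with ∈-map⁻ (_+ c) v∈
  ... | v , v∈L , refl rewrite m+n∸n≡m v c = irrefl m v∈L

  open ≡-Reasoning

  weight′ : ∀ {v} → v ∈ map (_+ c) L → sum (filterᵇ (adj′ v) (map (_+ c) L)) ≡ k + d * c
  weight′ v∈ with ∈-map⁻ (_+ c) v∈
  ... | v , v∈L , refl = begin
    sum (filterᵇ (adj′ (v + c)) (map (_+ c) L))
      ≡⟨ cong sum (filterᵇ-map (adj′ (v + c)) (_+ c) L) ⟩
    sum (map (_+ c) (filterᵇ (λ u → adj m (v + c ∸ c) (u + c ∸ c)) L))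
      ≡⟨ cong (sum ∘ map (_+ c)) (filterᵇ-cong (All.universal (λ u →
           cong₂ (adj m) (m+n∸n≡m v c) (m+n∸n≡m u c)) L)) ⟩
    sum (map (_+ c) (filterᵇ (adj m v) L))
      ≡⟨ sum-map-+ʳ c (filterᵇ (adj m v) L) ⟩
    sum (filterᵇ (adj m v) L) + length (filterᵇ (adj m v) L) * c
      ≡⟨ cong₂ (λ x y → x + y * c) (weight m v∈L) (regular v∈L) ⟩
    k + d * c ∎

-- Blocks of equal sum

Blocks : ℕ → List (List ℕ) → Set
Blocks s = All (λ block → sum block ≡ s)

sum-concat : ∀ {xss} → Blocks s xss → sum (concat xss) ≡ length xss * s
sum-concat []                         = refl
sum-concat {xss = xs ∷ xss} (eq ∷ eqs) =
  trans (sum-++ xs (concat xss)) (cong₂ _+_ eq (sum-concat eqs))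

-- A record, so that xss can be inferred.
record Realisable (k : ℕ) (xss : List (List ℕ)) : Set where
  constructor realise
  field
    magic-concat : Unique (concat xss) → Magic k (concat xss)

open Realisable

-- Each vertex sees every block but its own, hence the factor `length xss`. Joining `xs` adds `s` to
-- the weights in the other parts.
multipartite : ∀ {xs xss} → Blocks s (xs ∷ xss) → Realisable (length xss * s) (xs ∷ xss)
multipartite {xs = xs} {[]} _ = realise λ _ → independent (xs ++ [])
multipartite {s} {xs} {ys ∷ xss} (eq ∷ eqs) = realise λ xs++yss! →
  let _ , yss! , xs#yss = Unique-++⁻ xs xs++yss! in
  join xs#yss (independent xs) (magic-concat (multipartite eqs) yss!) (sum-concat eqs)
    (trans (cong (length xss * s +_) eq) (+-comm (length xss * s) s))

module _ (xss : List (List ℕ)) {yss : List (List ℕ)} where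

  Unique-concat-++⁻ : Unique (concat (xss ++ yss)) →
                      Unique (concat xss) × Unique (concat yss) × Disjoint (concat xss) (concat yss)
  Unique-concat-++⁻ = Unique-++⁻ (concat xss) ∘ subst Unique (sym (concat-++ xss yss))

  -- Each side is merged into one part of a complete bipartite graph; equally many blocks give equal
  -- sums.
  bipartite : length xss ≡ length yss → Blocks s xss → Blocks s yss →
              Realisable (length xss * s) (xss ++ yss)
  bipartite {s} len xs ys = realise λ xss++yss! →
    let _ , _ , xss#yss = Unique-concat-++⁻ xss++yss! in
    subst (Magic _) (concat-++ xss yss)
      (join xss#yss (independent (concat xss)) (independent (concat yss))
        (trans (sum-concat ys) (cong (_* s) (sym len))) (sum-concat xs))

  concat-union : Realisable k xss → Realisable k yss → Realisable k (xss ++ yss)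
  concat-union g h = realise λ xss++yss! →
    let xss! , yss! , xss#yss = Unique-concat-++⁻ xss++yss! in
    subst (Magic _) (concat-++ xss yss)
      (disjointUnion xss#yss (magic-concat g xss!) (magic-concat h yss!))

-- Consecutive blocks are matched in twos, each two forming a complete bipartite graph of weight
-- `s`.
fromEvenBlocks : ∀ t {xss} → length xss ≡ t * 2 → Blocks s xss → Realisable s xss
fromEvenBlocks {s} zero {[]} _ _ = realise λ _ → empty
fromEvenBlocks {s} (suc t) {xs ∷ ys ∷ xss} len (x ∷ y ∷ eqs) =
  concat-union (xs ∷ ys ∷ [])
    (subst (λ k → Realisable k (xs ∷ ys ∷ [])) (*-identityˡ s) (multipartite (x ∷ y ∷ [])))
    (fromEvenBlocks t (suc-injective (suc-injective len)) eqs)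
fromEvenBlocks (suc t) {_ ∷ []} ()

-- The numbers that are not of the form 3a + 4b.
unpackable : List ℕ
unpackable = 1 ∷ 2 ∷ 5 ∷ []

-- Three blocks form a complete tripartite graph, four blocks a complete bipartite one with two
-- blocks per side; unions of these reach every length outside `unpackable`.
fromBlocks : ∀ {xss} → length xss ∉ unpackable → Blocks s xss → Realisable (2 * s) xss
fromBlocks {xss = []} _ _ = realise λ _ → empty
fromBlocks {xss = _ ∷ []} ∉ = contradiction (here refl) ∉
fromBlocks {xss = _ ∷ _ ∷ []} ∉ = contradiction (there (here refl)) ∉
fromBlocks {xss = _ ∷ _ ∷ _ ∷ []} _ eqs = multipartite eqs
fromBlocks {xss = a ∷ b ∷ _ ∷ _ ∷ []} _ (p ∷ q ∷ eqs) =
  bipartite (a ∷ b ∷ []) refl (p ∷ q ∷ []) eqs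
fromBlocks {xss = _ ∷ _ ∷ _ ∷ _ ∷ _ ∷ []} ∉ = contradiction (there (there (here refl))) ∉
fromBlocks {xss = a ∷ b ∷ c ∷ _ ∷ _ ∷ _ ∷ []} _ (p ∷ q ∷ r ∷ eqs) =
  concat-union (a ∷ b ∷ c ∷ []) (multipartite (p ∷ q ∷ r ∷ [])) (multipartite eqs)
fromBlocks {xss = a ∷ b ∷ c ∷ d ∷ e ∷ _ ∷ _ ∷ []} _ (p ∷ q ∷ r ∷ t ∷ u ∷ eqs) =
  concat-union (a ∷ b ∷ c ∷ []) (multipartite (p ∷ q ∷ r ∷ []))
    (bipartite (d ∷ e ∷ []) refl (t ∷ u ∷ []) eqs)
fromBlocks {xss = a ∷ b ∷ c ∷ d ∷ e ∷ f ∷ _ ∷ _ ∷ []} _ (p ∷ q ∷ r ∷ t ∷ u ∷ v ∷ eqs) =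
  concat-union (a ∷ b ∷ c ∷ d ∷ []) (bipartite (a ∷ b ∷ []) refl (p ∷ q ∷ []) (r ∷ t ∷ []))
    (bipartite (e ∷ f ∷ []) refl (u ∷ v ∷ []) eqs)
-- At least six blocks remain, so their number is again not in `unpackable`.
fromBlocks {xss = a ∷ b ∷ c ∷ xss@(_ ∷ _ ∷ _ ∷ _ ∷ _ ∷ _ ∷ _)} _ (p ∷ q ∷ r ∷ eqs) =
  concat-union (a ∷ b ∷ c ∷ []) (multipartite (p ∷ q ∷ r ∷ []))
    (fromBlocks {xss = xss} (λ where (there (there (there ())))) eqs)

-- Pairing the ends of an interval

labels-∷ʳ : ∀ a n → labels a (suc n) ≡ labels a n ∷ʳ (a + n)
labels-∷ʳ a zero    = cong (_∷ []) (sym (+-identityʳ a))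
labels-∷ʳ a (suc n) = cong (a ∷_) (trans (labels-∷ʳ (suc a) n)
  (cong (labels (suc a) n ∷ʳ_) (sym (+-suc a n))))

-- The p outermost pairs, from the outside inwards, of the interval of length
-- p * 2 + n that starts at a.
pairs : ℕ → ℕ → ℕ → List (List ℕ)
pairs a n zero    = []
pairs a n (suc p) = (a ∷ a + suc (p * 2 + n) ∷ []) ∷ pairs (suc a) n p

length-pairs : ∀ a n p → length (pairs a n p) ≡ p
length-pairs a n zero    = refl
length-pairs a n (suc p) = cong suc (length-pairs (suc a) n p)

-- The first and last labels sum to `s`; `suc s` avoids a truncated subtraction. One step inwards
-- raises `a` by one and shortens the interval by two, which keeps the sum.
pairs-blocks : ∀ a n p → suc s ≡ a * 2 + (p * 2 + n) → Blocks s (pairs a n p)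
pairs-blocks a n zero    eq = []
pairs-blocks a n (suc p) eq =
  suc-injective (trans (lemma₁ a (p * 2 + n)) (sym eq)) ∷
  pairs-blocks (suc a) n p (trans eq (lemma₂ (a * 2) (p * 2 + n)))
  where
  lemma₁ : ∀ a x → suc (a + (a + suc x + 0)) ≡ a * 2 + suc (suc x)
  lemma₁ = solve-∀

  lemma₂ : ∀ y x → y + suc (suc x) ≡ suc (suc y) + x
  lemma₂ = solve-∀

labels-↭-pairs : ∀ a n p → labels a (p * 2 + n) ↭ concat (pairs a n p) ++ labels (a + p) n
labels-↭-pairs a n zero rewrite +-identityʳ a = ↭-refl
labels-↭-pairs a n (suc p) = ↭-prep a (begin
  labels (suc a) (suc (p * 2 + n))
    ≡⟨ labels-∷ʳ (suc a) (p * 2 + n) ⟩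
  labels (suc a) (p * 2 + n) ∷ʳ (suc a + (p * 2 + n))
    ↭⟨ ∷↭∷ʳ _ (labels (suc a) (p * 2 + n)) ⟨
  suc a + (p * 2 + n) ∷ labels (suc a) (p * 2 + n)
    ≡⟨ cong (_∷ labels (suc a) (p * 2 + n)) (sym (+-suc a (p * 2 + n))) ⟩
  a + suc (p * 2 + n) ∷ labels (suc a) (p * 2 + n)
    ↭⟨ ↭-prep _ (labels-↭-pairs (suc a) n p) ⟩
  a + suc (p * 2 + n) ∷ concat (pairs (suc a) n p) ++ labels (suc a + p) n
    ≡⟨ cong (λ c → a + suc (p * 2 + n) ∷ concat (pairs (suc a) n p) ++ labels c n)
         (sym (+-suc a p)) ⟩
  a + suc (p * 2 + n) ∷ concat (pairs (suc a) n p) ++ labels (a + suc p) n ∎)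
  where open PermutationReasoning

-- Explicit graphs

-- The i-th row, counted from 1, lists the neighbours of the vertex labelled i.
module Table (rows : List (List ℕ)) where

  row : List (List ℕ) → ℕ → List ℕ
  row []         _       = []
  row (ns ∷ _)   zero    = ns
  row (_ ∷ rows) (suc i) = row rows i

  ns : List ℕ
  ns = labels 1 (length rows)

  adjᵗ : ℕ → ℕ → Bool
  -- The dummy row for 0 aligns rows with labels, which start at 1.
  adjᵗ u v = any (v ≡ᵇ_) (row ([] ∷ rows) u)

  magic? : ∀ k → Dec (All (λ u → All (λ v → adjᵗ u v ≡ adjᵗ v u) ns) ns ×
                      All (λ v → adjᵗ v v ≡ false) ns ×
                      All (λ v → sum (filterᵇ (adjᵗ v) ns) ≡ k) ns)
  magic? k = all? (λ u → all? (λ v → adjᵗ u v Bool.≟ adjᵗ v u) ns) ns ×-dec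
             all? (λ v → adjᵗ v v Bool.≟ false) ns ×-dec
             all? (λ v → sum (filterᵇ (adjᵗ v) ns) ≟ k) ns

  regular? : ∀ d → Dec (All (λ v → length (filterᵇ (adjᵗ v) ns) ≡ d) ns)
  regular? d = all? (λ v → length (filterᵇ (adjᵗ v) ns) ≟ d) ns

  magic : {True (magic? k)} → Magic k ns
  magic {k} {checked} = record
    { adj    = adjᵗ
    ; sym-on = λ u∈ → All.lookup (All.lookup (proj₁ props) u∈)
    ; irrefl = All.lookup (proj₁ (proj₂ props))
    ; weight = All.lookup (proj₂ (proj₂ props))
    }
    where props = toWitness {a? = magic? k} checked

tabulated : ∀ rows → {True (0 <? length rows)} → {True (Table.magic? rows k)} → IsMagicConstant k
tabulated rows {nonempty} {checked} =
  magic⇒constant (toWitness nonempty) ↭-refl (Table.magic rows {_} {checked})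

-- The sum 5 has only two pairs; this is the complete tripartite graph with parts {1, 4}, {2, 3} and
-- {5}.
magic-10 : IsMagicConstant 10
magic-10 = tabulated
  ( (2 ∷ 3 ∷ 5 ∷ [])
  ∷ (1 ∷ 4 ∷ 5 ∷ [])
  ∷ (1 ∷ 4 ∷ 5 ∷ [])
  ∷ (2 ∷ 3 ∷ 5 ∷ [])
  ∷ (1 ∷ 2 ∷ 3 ∷ 4 ∷ [])
  ∷ [])

-- Six blocks of sum 20, matched into three complete bipartite graphs.
magic-20 : IsMagicConstant 20
magic-20 = tabulated
  ( (2 ∷ 7 ∷ 11 ∷ [])
  ∷ (1 ∷ 9 ∷ 10 ∷ [])
  ∷ (5 ∷ 15 ∷ [])
  ∷ (5 ∷ 15 ∷ [])
  ∷ (3 ∷ 4 ∷ 13 ∷ [])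
  ∷ (8 ∷ 12 ∷ [])
  ∷ (1 ∷ 9 ∷ 10 ∷ [])
  ∷ (6 ∷ 14 ∷ [])
  ∷ (2 ∷ 7 ∷ 11 ∷ [])
  ∷ (2 ∷ 7 ∷ 11 ∷ [])
  ∷ (1 ∷ 9 ∷ 10 ∷ [])
  ∷ (6 ∷ 14 ∷ [])
  ∷ (5 ∷ 15 ∷ [])
  ∷ (8 ∷ 12 ∷ [])
  ∷ (3 ∷ 4 ∷ 13 ∷ [])
  ∷ [])

-- Five pairs of sum 11 cannot be grouped in threes and fours; here they replace the vertices of a
-- 5-cycle.
magic-22 : IsMagicConstant 22
magic-22 = tabulated
  ( (2 ∷ 5 ∷ 6 ∷ 9 ∷ [])
  ∷ (1 ∷ 4 ∷ 7 ∷ 10 ∷ [])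
  ∷ (4 ∷ 5 ∷ 6 ∷ 7 ∷ [])
  ∷ (2 ∷ 3 ∷ 8 ∷ 9 ∷ [])
  ∷ (1 ∷ 3 ∷ 8 ∷ 10 ∷ [])
  ∷ (1 ∷ 3 ∷ 8 ∷ 10 ∷ [])
  ∷ (2 ∷ 3 ∷ 8 ∷ 9 ∷ [])
  ∷ (4 ∷ 5 ∷ 6 ∷ 7 ∷ [])
  ∷ (1 ∷ 4 ∷ 7 ∷ 10 ∷ [])
  ∷ (2 ∷ 5 ∷ 6 ∷ 9 ∷ [])
  ∷ [])

-- Complete tripartite with parts {1, 2, 3, 6}, {4, 8} and {5, 7}.
magic-24 : IsMagicConstant 24
magic-24 = tabulated
  ( (4 ∷ 5 ∷ 7 ∷ 8 ∷ [])
  ∷ (4 ∷ 5 ∷ 7 ∷ 8 ∷ [])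
  ∷ (4 ∷ 5 ∷ 7 ∷ 8 ∷ [])
  ∷ (1 ∷ 2 ∷ 3 ∷ 5 ∷ 6 ∷ 7 ∷ [])
  ∷ (1 ∷ 2 ∷ 3 ∷ 4 ∷ 6 ∷ 8 ∷ [])
  ∷ (4 ∷ 5 ∷ 7 ∷ 8 ∷ [])
  ∷ (1 ∷ 2 ∷ 3 ∷ 4 ∷ 6 ∷ 8 ∷ [])
  ∷ (1 ∷ 2 ∷ 3 ∷ 5 ∷ 6 ∷ 7 ∷ [])
  ∷ [])

magic-28 : IsMagicConstant 28
magic-28 = tabulated
  ( (2 ∷ 3 ∷ 8 ∷ 15 ∷ [])
  ∷ (1 ∷ 12 ∷ 15 ∷ [])
  ∷ (1 ∷ 6 ∷ 10 ∷ 11 ∷ [])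
  ∷ (5 ∷ 9 ∷ 14 ∷ [])
  ∷ (4 ∷ 6 ∷ 8 ∷ 10 ∷ [])
  ∷ (3 ∷ 5 ∷ 8 ∷ 12 ∷ [])
  ∷ (12 ∷ 16 ∷ [])
  ∷ (1 ∷ 5 ∷ 6 ∷ 16 ∷ [])
  ∷ (4 ∷ 10 ∷ 14 ∷ [])
  ∷ (3 ∷ 5 ∷ 9 ∷ 11 ∷ [])
  ∷ (3 ∷ 10 ∷ 15 ∷ [])
  ∷ (2 ∷ 6 ∷ 7 ∷ 13 ∷ [])
  ∷ (12 ∷ 16 ∷ [])
  ∷ (4 ∷ 9 ∷ 15 ∷ [])
  ∷ (1 ∷ 2 ∷ 11 ∷ 14 ∷ [])
  ∷ (7 ∷ 8 ∷ 13 ∷ [])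
  ∷ [])

magic-32 : IsMagicConstant 32
magic-32 = tabulated
  ( (2 ∷ 4 ∷ 5 ∷ 6 ∷ 7 ∷ 8 ∷ [])
  ∷ (1 ∷ 4 ∷ 6 ∷ 10 ∷ 11 ∷ [])
  ∷ (5 ∷ 6 ∷ 10 ∷ 11 ∷ [])
  ∷ (1 ∷ 2 ∷ 8 ∷ 10 ∷ 11 ∷ [])
  ∷ (1 ∷ 3 ∷ 7 ∷ 9 ∷ 12 ∷ [])
  ∷ (1 ∷ 2 ∷ 3 ∷ 7 ∷ 8 ∷ 11 ∷ [])
  ∷ (1 ∷ 5 ∷ 6 ∷ 9 ∷ 11 ∷ [])
  ∷ (1 ∷ 4 ∷ 6 ∷ 9 ∷ 12 ∷ [])
  ∷ (5 ∷ 7 ∷ 8 ∷ 12 ∷ [])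
  ∷ (2 ∷ 3 ∷ 4 ∷ 11 ∷ 12 ∷ [])
  ∷ (2 ∷ 3 ∷ 4 ∷ 6 ∷ 7 ∷ 10 ∷ [])
  ∷ (5 ∷ 8 ∷ 9 ∷ 10 ∷ [])
  ∷ [])

magic-40 : IsMagicConstant 40
magic-40 = tabulated
  ( (4 ∷ 6 ∷ 7 ∷ 11 ∷ 12 ∷ [])
  ∷ (5 ∷ 7 ∷ 8 ∷ 9 ∷ 11 ∷ [])
  ∷ (8 ∷ 9 ∷ 11 ∷ 12 ∷ [])
  ∷ (1 ∷ 5 ∷ 6 ∷ 8 ∷ 9 ∷ 11 ∷ [])
  ∷ (2 ∷ 4 ∷ 6 ∷ 7 ∷ 10 ∷ 11 ∷ [])
  ∷ (1 ∷ 4 ∷ 5 ∷ 9 ∷ 10 ∷ 11 ∷ [])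
  ∷ (1 ∷ 2 ∷ 5 ∷ 9 ∷ 11 ∷ 12 ∷ [])
  ∷ (2 ∷ 3 ∷ 4 ∷ 9 ∷ 10 ∷ 12 ∷ [])
  ∷ (2 ∷ 3 ∷ 4 ∷ 6 ∷ 7 ∷ 8 ∷ 10 ∷ [])
  ∷ (5 ∷ 6 ∷ 8 ∷ 9 ∷ 12 ∷ [])
  ∷ (1 ∷ 2 ∷ 3 ∷ 4 ∷ 5 ∷ 6 ∷ 7 ∷ 12 ∷ [])
  ∷ (1 ∷ 3 ∷ 7 ∷ 8 ∷ 10 ∷ 11 ∷ [])
  ∷ [])

-- Complete tripartite with parts {1, 4, 8, 9}, {2, 3, 6, 11} and {5, 7, 10}.
magic-44 : IsMagicConstant 44
magic-44 = tabulated
  ( (2 ∷ 3 ∷ 5 ∷ 6 ∷ 7 ∷ 10 ∷ 11 ∷ [])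
  ∷ (1 ∷ 4 ∷ 5 ∷ 7 ∷ 8 ∷ 9 ∷ 10 ∷ [])
  ∷ (1 ∷ 4 ∷ 5 ∷ 7 ∷ 8 ∷ 9 ∷ 10 ∷ [])
  ∷ (2 ∷ 3 ∷ 5 ∷ 6 ∷ 7 ∷ 10 ∷ 11 ∷ [])
  ∷ (1 ∷ 2 ∷ 3 ∷ 4 ∷ 6 ∷ 8 ∷ 9 ∷ 11 ∷ [])
  ∷ (1 ∷ 4 ∷ 5 ∷ 7 ∷ 8 ∷ 9 ∷ 10 ∷ [])
  ∷ (1 ∷ 2 ∷ 3 ∷ 4 ∷ 6 ∷ 8 ∷ 9 ∷ 11 ∷ [])
  ∷ (2 ∷ 3 ∷ 5 ∷ 6 ∷ 7 ∷ 10 ∷ 11 ∷ [])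
  ∷ (2 ∷ 3 ∷ 5 ∷ 6 ∷ 7 ∷ 10 ∷ 11 ∷ [])
  ∷ (1 ∷ 2 ∷ 3 ∷ 4 ∷ 6 ∷ 8 ∷ 9 ∷ 11 ∷ [])
  ∷ (1 ∷ 4 ∷ 5 ∷ 7 ∷ 8 ∷ 9 ∷ 10 ∷ [])
  ∷ [])

magic-56 : IsMagicConstant 56
magic-56 = tabulated
  ( (4 ∷ 5 ∷ 8 ∷ 12 ∷ 13 ∷ 14 ∷ [])
  ∷ (5 ∷ 6 ∷ 9 ∷ 10 ∷ 12 ∷ 14 ∷ [])
  ∷ (7 ∷ 10 ∷ 12 ∷ 13 ∷ 14 ∷ [])
  ∷ (1 ∷ 5 ∷ 7 ∷ 9 ∷ 10 ∷ 11 ∷ 13 ∷ [])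
  ∷ (1 ∷ 2 ∷ 4 ∷ 10 ∷ 12 ∷ 13 ∷ 14 ∷ [])
  ∷ (2 ∷ 7 ∷ 8 ∷ 12 ∷ 13 ∷ 14 ∷ [])
  ∷ (3 ∷ 4 ∷ 6 ∷ 8 ∷ 9 ∷ 12 ∷ 14 ∷ [])
  ∷ (1 ∷ 6 ∷ 7 ∷ 9 ∷ 10 ∷ 11 ∷ 12 ∷ [])
  ∷ (2 ∷ 4 ∷ 7 ∷ 8 ∷ 10 ∷ 11 ∷ 14 ∷ [])
  ∷ (2 ∷ 3 ∷ 4 ∷ 5 ∷ 8 ∷ 9 ∷ 11 ∷ 14 ∷ [])
  ∷ (4 ∷ 8 ∷ 9 ∷ 10 ∷ 12 ∷ 13 ∷ [])
  ∷ (1 ∷ 2 ∷ 3 ∷ 5 ∷ 6 ∷ 7 ∷ 8 ∷ 11 ∷ 13 ∷ [])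
  ∷ (1 ∷ 3 ∷ 4 ∷ 5 ∷ 6 ∷ 11 ∷ 12 ∷ 14 ∷ [])
  ∷ (1 ∷ 2 ∷ 3 ∷ 5 ∷ 6 ∷ 7 ∷ 9 ∷ 10 ∷ 13 ∷ [])
  ∷ [])

regular-17 : List (List ℕ)
regular-17 =
  ( (4 ∷ 5 ∷ 12 ∷ 15 ∷ [])
  ∷ (3 ∷ 8 ∷ 10 ∷ 15 ∷ [])
  ∷ (2 ∷ 9 ∷ 11 ∷ 14 ∷ [])
  ∷ (1 ∷ 6 ∷ 13 ∷ 16 ∷ [])
  ∷ (1 ∷ 7 ∷ 11 ∷ 17 ∷ [])
  ∷ (4 ∷ 7 ∷ 9 ∷ 16 ∷ [])
  ∷ (5 ∷ 6 ∷ 8 ∷ 17 ∷ [])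
  ∷ (2 ∷ 7 ∷ 13 ∷ 14 ∷ [])
  ∷ (3 ∷ 6 ∷ 10 ∷ 17 ∷ [])
  ∷ (2 ∷ 9 ∷ 12 ∷ 13 ∷ [])
  ∷ (3 ∷ 5 ∷ 12 ∷ 16 ∷ [])
  ∷ (1 ∷ 10 ∷ 11 ∷ 14 ∷ [])
  ∷ (4 ∷ 8 ∷ 10 ∷ 14 ∷ [])
  ∷ (3 ∷ 8 ∷ 12 ∷ 13 ∷ [])
  ∷ (1 ∷ 2 ∷ 16 ∷ 17 ∷ [])
  ∷ (4 ∷ 6 ∷ 11 ∷ 15 ∷ [])
  ∷ (5 ∷ 7 ∷ 9 ∷ 15 ∷ [])
  ∷ [])

-- With `q = 9 + c` the labels run from `q - 8` to `q + 8` and the weight is `4 * q`.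
translated-regular-17 : ∀ c → Magic (36 + 4 * c) (labels (1 + c) 17)
translated-regular-17 c = translate {36} c 4 (Table.magic regular-17)
  (All.lookup (from-yes (Table.regular? regular-17 4)))

-- Infinite families

halve : ∀ n → ∃ λ m → n ≡ m * 2 ⊎ n ≡ suc (m * 2)
halve zero    = 0 , inj₁ refl
halve (suc n) with halve n
... | m , inj₁ eq = m , inj₂ (cong suc eq)
... | m , inj₂ eq = suc m , inj₁ (cong suc eq)

labels-↭-all-pairs : ∀ t → labels 1 (t * 2) ↭ concat (pairs 1 0 t)
labels-↭-all-pairs t = subst₂ _↭_ (cong (labels 1) (+-identityʳ (t * 2)))
  (++-identityʳ (concat (pairs 1 0 t))) (labels-↭-pairs 1 0 t)

all-pairs-blocks : ∀ t → Blocks (suc (t * 2)) (pairs 1 0 t)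
all-pairs-blocks t = pairs-blocks 1 0 t (cong (2 +_) (sym (+-identityʳ (t * 2))))

realisable⇒constant : ∀ {xss} → 0 < n → labels 1 n ↭ concat xss → Realisable k xss →
                      IsMagicConstant k
realisable⇒constant {n} 0<n p r =
  magic⇒constant 0<n p (magic-concat r (Unique-resp-↭ p (labels-unique 1 n)))

-- The labels below the constant split into `suc t` pairs summing to it. If `suc t` is odd, the
-- constant itself is added as a singleton block to make the number of blocks even.
odd-constant : ∀ t → IsMagicConstant (suc (suc t * 2))
odd-constant t with halve (suc t)
... | j , inj₁ eq = realisable⇒constant z<s (labels-↭-all-pairs (suc t))
  (fromEvenBlocks j (trans (length-pairs 1 0 (suc t)) eq) (all-pairs-blocks (suc t)))
... | j , inj₂ eq = realisable⇒constant {xss = (top ∷ []) ∷ pairs 1 0 (suc t)} z<s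
  (begin
    labels 1 top                            ≡⟨ labels-∷ʳ 1 (suc t * 2) ⟩
    labels 1 (suc t * 2) ∷ʳ top             ↭⟨ ∷↭∷ʳ top (labels 1 (suc t * 2)) ⟨
    top ∷ labels 1 (suc t * 2)              ↭⟨ ↭-prep top (labels-↭-all-pairs (suc t)) ⟩
    top ∷ concat (pairs 1 0 (suc t))        ∎)
  (fromEvenBlocks (suc j) (cong suc (trans (length-pairs 1 0 (suc t)) eq))
    (+-identityʳ top ∷ all-pairs-blocks (suc t)))
  where
  open PermutationReasoning
  top = suc (suc t * 2)

twice-odd-constant : ∀ t → suc t ∉ unpackable → IsMagicConstant (suc (suc t * 2) * 2)
twice-odd-constant t ∉ = subst IsMagicConstant (*-comm 2 (suc (suc t * 2)))
  (realisable⇒constant z<s (labels-↭-all-pairs (suc t))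
    (fromBlocks (∉ ∘ subst (_∈ unpackable) (length-pairs 1 0 (suc t))) (all-pairs-blocks (suc t))))

-- The constant is `4 * q` with `q = 9 + p`; `p` outer pairs of sum `2 * q` surround the 17 middle
-- labels.
multiple-of-4-constant : ∀ p → p ∉ unpackable → IsMagicConstant ((9 + p) * 2 * 2)
multiple-of-4-constant p ∉ = subst IsMagicConstant (lemma₃ p)
  (magic⇒constant (≤-trans z<s (m≤n+m 17 (p * 2))) perm
    (disjointUnion disjoint outer (translated-regular-17 p)))
  where
  lemma₁ : ∀ x → 19 + x ≡ 2 + (x + 17)
  lemma₁ = solve-∀

  lemma₂ : ∀ p → 2 * (18 + p * 2) ≡ 36 + 4 * p
  lemma₂ = solve-∀

  lemma₃ : ∀ p → 36 + 4 * p ≡ (9 + p) * 2 * 2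
  lemma₃ = solve-∀

  perm : labels 1 (p * 2 + 17) ↭ concat (pairs 1 17 p) ++ labels (1 + p) 17
  perm = labels-↭-pairs 1 17 p

  split = Unique-++⁻ (concat (pairs 1 17 p)) (Unique-resp-↭ perm (labels-unique 1 (p * 2 + 17)))
  disjoint = proj₂ (proj₂ split)

  outer : Magic (36 + 4 * p) (concat (pairs 1 17 p))
  outer = subst (λ k → Magic k (concat (pairs 1 17 p))) (lemma₂ p)
    (magic-concat
      (fromBlocks (∉ ∘ subst (_∈ unpackable) (length-pairs 1 17 p))
        -- The common sum is `18 + p * 2`: first label 1 plus last label `p * 2 + 17`.
        (pairs-blocks 1 17 p (lemma₁ (p * 2))))
      (proj₁ split))

constant : ∀ k → 0 < k → k ∉ exceptions → IsMagicConstant k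
constant k 0<k k∉ with halve k
... | zero  , inj₂ refl = contradiction (here refl) k∉
... | suc t , inj₂ refl = odd-constant t
... | m     , inj₁ refl with halve m
...   | zero  , inj₂ refl = contradiction (there (here refl)) k∉
-- There are `suc t` pairs; the counts 1, 2 and 5 belong to the constants 6, 10 and 22.
...   | suc t , inj₂ refl with suc t ∈? unpackable
...     | no ∉                             = twice-odd-constant t ∉
...     | yes (here refl)                  = contradiction (from-yes (6 ∈? exceptions)) k∉
...     | yes (there (here refl))          = magic-10
...     | yes (there (there (here refl)))  = magic-22
constant k 0<k k∉ | m , inj₁ refl | q , inj₁ refl = multiple-of-4 q 0<k k∉
  where
  multiple-of-4 : ∀ q → 0 < q * 2 * 2 → q * 2 * 2 ∉ exceptions →
                  IsMagicConstant (q * 2 * 2)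
  multiple-of-4 0 ()
  multiple-of-4 1 _ ∉ = contradiction (from-yes (4 ∈? exceptions)) ∉
  multiple-of-4 2 _ ∉ = contradiction (from-yes (8 ∈? exceptions)) ∉
  multiple-of-4 3 _ ∉ = contradiction (from-yes (12 ∈? exceptions)) ∉
  multiple-of-4 4 _ ∉ = contradiction (from-yes (16 ∈? exceptions)) ∉
  multiple-of-4 5 _ _ = magic-20
  multiple-of-4 6 _ _ = magic-24
  multiple-of-4 7 _ _ = magic-28
  multiple-of-4 8 _ _ = magic-32
  -- Now `q = 9 + p`; the unpackable counts 1, 2 and 5 of outer pairs belong to 40, 44 and 56.
  multiple-of-4 (suc (suc (suc (suc (suc (suc (suc (suc (suc p))))))))) _ _ with p ∈? unpackable
  ... | no ∉                            = multiple-of-4-constant p ∉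
  ... | yes (here refl)                 = magic-40
  ... | yes (there (here refl))         = magic-44
  ... | yes (there (there (here refl))) = magic-56

theorem4p1 : (k : ℕ) → 0 < k →
    IsMagicConstant k ⇔ (k ∉ (1 ∷ 2 ∷ 4 ∷ 6 ∷ 8 ∷ 12 ∷ 16 ∷ []))
theorem4p1 k 0<k = mk⇔ (λ magic k∈ → not-constant 0<k k∈ magic) (constant k 0<k)
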